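{- For every nonnegative integer $n$, $$\sum_{k=0}^{\infty}(-1)^k(4k+1)\,\frac{(-2n)_k\,(-3n-\tfrac14)_k\,(\tfrac12)_k}{k!\,(2n+\tfrac32)_k\,(3n+\tfrac74)_k}=\left(\frac{2^2 3^3}{5^5}\right)^n\frac{(\tfrac{11}{12})_n(\tfrac{7}{12})_n(\tfrac54)_n^2}{(\tfrac{11}{20})_n(\tfrac{19}{20})_n(\tfrac{23}{20})_n(\tfrac{7}{20})_n}.$$ (The sum is finite, since $(-2n)_k=0$ for $k>2n$.)
   Context: $(a)_j=\Gamma(a+j)/\Gamma(a)=a(a+1)\cdots(a+j-1)$ denotes the rising factorial (Pochhammer symbol), with $(a)_0=1$. -}

module Defs where

open import Data.Nat.Base as ℕ using (ℕ; zero; suc; _!)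
open import Data.Nat.Properties using (_!≢0)
open import Data.Integer.Base using (+_)
open import Data.Fin.Base using (toℕ)
open import Data.Product.Base using (∃-syntax)
open import Data.Rational.Base
open import Data.Rational.Properties
open import Algebra.Definitions.RawSemiring +-*-rawSemiring using (_^_)
open import Algebra.Properties.Monoid.Sum +-0-monoid using (sum-syntax)
open import Relation.Binary.PropositionalEquality.Core using (subst)

fromℕ : ℕ → ℚ
fromℕ n = + n / 1

rising : ℚ → ℕ → ℚ
rising a zero    = 1ℚ
rising a (suc j) = rising a j * (a + fromℕ j)

-- s is the limit of the partial sums; rational ε suffice, as s and all terms are rational.
_HasSum_ : (ℕ → ℚ) → ℚ → Set
f HasSum s = ∀ ε → 0ℚ < ε →
  ∃[ M ] ∀ N → M ℕ.≤ N → ∣ (∑[ k < N ] f (toℕ k)) - s ∣ < ε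

*-pos : ∀ {p q} → 0ℚ < p → 0ℚ < q → 0ℚ < p * q
*-pos {p} {q} p>0 q>0 =
  positive⁻¹ (p * q) {{pos*pos⇒pos p {{positive p>0}} q {{positive q>0}}}}

fromℕ+-pos : ∀ n {q} → 0ℚ < q → 0ℚ < fromℕ n + q
fromℕ+-pos n q>0 =
  +-mono-≤-< (nonNegative⁻¹ (fromℕ n) {{normalize-nonNeg n 1}}) q>0

rising-pos : ∀ {a} → 0ℚ < a → ∀ j → 0ℚ < rising a j
rising-pos     a>0 zero    = positive⁻¹ 1ℚ
rising-pos {a} a>0 (suc j) =
  *-pos (rising-pos a>0 j)
        (subst (0ℚ <_) (+-comm (fromℕ j) a) (fromℕ+-pos j a>0))

factorial-pos : ∀ k → 0ℚ < fromℕ (k !)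
factorial-pos k =
  positive⁻¹ (fromℕ (k !)) {{normalize-pos (k !) 1 {{_}} {{k !≢0}}}}

summandDenominator : ℕ → ℕ → ℚ
summandDenominator n k =
    fromℕ (k !)
  * rising (fromℕ (2 ℕ.* n) + + 3 / 2) k
  * rising (fromℕ (3 ℕ.* n) + + 7 / 4) k

summandDenominator-nonZero : ∀ n k → NonZero (summandDenominator n k)
summandDenominator-nonZero n k = >-nonZero
  (*-pos (*-pos (factorial-pos k)
                (rising-pos (fromℕ+-pos (2 ℕ.* n) (positive⁻¹ (+ 3 / 2))) k))
         (rising-pos (fromℕ+-pos (3 ℕ.* n) (positive⁻¹ (+ 7 / 4))) k))

summand : ℕ → ℕ → ℚ
summand n k =
    (- 1ℚ) ^ k * fromℕ (4 ℕ.* k ℕ.+ 1)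
  * (  ( rising (- fromℕ (2 ℕ.* n)) k
       * rising (- fromℕ (3 ℕ.* n) - + 1 / 4) k
       * rising (+ 1 / 2) k )
    ÷ summandDenominator n k )
  where instance _ = summandDenominator-nonZero n k

productDenominator : ℕ → ℚ
productDenominator n =
    rising (+ 11 / 20) n * rising (+ 19 / 20) n
  * rising (+ 23 / 20) n * rising (+ 7 / 20) n

productDenominator-nonZero : ∀ n → NonZero (productDenominator n)
productDenominator-nonZero n = >-nonZero
  (*-pos (*-pos (*-pos (rising-pos (positive⁻¹ (+ 11 / 20)) n)
                       (rising-pos (positive⁻¹ (+ 19 / 20)) n))
                (rising-pos (positive⁻¹ (+ 23 / 20)) n))
         (rising-pos (positive⁻¹ (+ 7 / 20)) n))

productSide : ℕ → ℚ
productSide n =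
    (+ (2 ℕ.^ 2 ℕ.* 3 ℕ.^ 3) / (5 ℕ.^ 5)) ^ n
  * (  ( rising (+ 11 / 12) n * rising (+ 7 / 12) n * rising (+ 5 / 4) n ^ 2 )
    ÷ productDenominator n )
  where instance _ = productDenominator-nonZero n

{-# OPTIONS --safe #-}
module Submission where

-- The series is the very-well-poised sum with a = 1/2, N = 2n, d = 3n + 7/4 and
-- c = 1 + a - d.  For arbitrary positive a and d, Zeilberger's algorithm gives
-- (d + N) S(N+1) = (1 + a + N) S(N), whence S(N) = a (1 + a)_N / (d)_N.  The stated
-- product then comes from the multiplication formula for (3/2)_{2n}, (7/4)_{3n}
-- and (7/4)_{5n} = (7/4)_{3n} (3n + 7/4)_{2n}.

open import Defs
import Algebra.Properties.CommutativeMonoid.Sum as BigOperator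
import Algebra.Properties.CommutativeSemiring.Exp as Exp
open import Algebra.Bundles using (module CommutativeRing)
open import Data.Fin.Base as Fin using (toℕ)
open import Data.Fin.Properties using (toℕ-inject₁; toℕ-fromℕ)
open import Data.Integer.Base as ℤ using (+_)
import Data.Integer.Properties as ℤ
open import Data.Nat.Base as ℕ using (ℕ; zero; suc; _!)
import Data.Nat.Properties as ℕ
open import Data.Product.Base using (_,_)
open import Data.Rational.Base
open import Data.Rational.Properties
import Data.Rational.Unnormalised.Base as ℚᵘ
import Data.Rational.Unnormalised.Properties as ℚᵘ
open import Function.Base using (_∘_)
open import Level using (0ℓ)
open import Relation.Binary.PropositionalEquality
open import Relation.Nullary.Decidable using (dec⇒maybe)
open import Tactic.RingSolver using (solve-∀)
open import Tactic.RingSolver.Core.AlmostCommutativeRing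
  using (AlmostCommutativeRing; fromCommutativeRing)

open import Algebra.Definitions.RawSemiring +-*-rawSemiring using (_^_)
open BigOperator +-0-commutativeMonoid using (sum-syntax; sum-init-last; sum-cong-≗)
open BigOperator *-1-commutativeMonoid using ()
  renaming ( sum to product; sum-init-last to product-init-last
           ; sum-cong-≗ to product-cong; ∑-distrib-+ to product-distrib-*
           ; sum-replicate to product-replicate )
open import Algebra.Properties.Semiring.Sum
  (CommutativeRing.semiring +-*-commutativeRing) using (*-distribˡ-sum)
open Exp (CommutativeRing.commutativeSemiring +-*-commutativeRing) using (^-distrib-*)

-- Notation, the embedding of the naturals, and reciprocals of positive rationals.

product-syntax : ∀ n → (Fin.Fin n → ℚ) → ℚ
product-syntax _ = product

syntax product-syntax n (λ i → x) = ∏[ i < n ] x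

ring : AlmostCommutativeRing 0ℓ 0ℓ
ring = fromCommutativeRing +-*-commutativeRing (λ p → dec⇒maybe (0ℚ ≟ p))

-- Normalising `+ n / 1` passes through a gcd that is stuck for a variable `n`, so the equation is
-- checked on unnormalised fractions, where all denominators are visibly 1.
fromℕ-+ : ∀ m n → fromℕ (m ℕ.+ n) ≡ fromℕ m + fromℕ n
fromℕ-+ m n = toℚᵘ-injective (begin-equality
  toℚᵘ (fromℕ (m ℕ.+ n))                    ≃⟨ toℚᵘ-fromℚᵘ (ℚᵘ.mkℚᵘ (+ (m ℕ.+ n)) 0) ⟩
  ℚᵘ.mkℚᵘ (+ (m ℕ.+ n)) 0                   ≡⟨ cong₂ (λ i j → ℚᵘ.mkℚᵘ (i ℤ.+ j) 0)
                                                 (ℤ.*-identityʳ (+ m)) (ℤ.*-identityʳ (+ n)) ⟨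
  ℚᵘ.mkℚᵘ (+ m) 0 ℚᵘ.+ ℚᵘ.mkℚᵘ (+ n) 0      ≃⟨ ℚᵘ.+-cong (toℚᵘ-fromℚᵘ (ℚᵘ.mkℚᵘ (+ m) 0))
                                                         (toℚᵘ-fromℚᵘ (ℚᵘ.mkℚᵘ (+ n) 0)) ⟨
  toℚᵘ (fromℕ m) ℚᵘ.+ toℚᵘ (fromℕ n)        ≃⟨ toℚᵘ-homo-+ (fromℕ m) (fromℕ n) ⟨
  toℚᵘ (fromℕ m + fromℕ n)                  ∎)
  where open ℚᵘ.≤-Reasoning

open ≡-Reasoning

fromℕ-suc : ∀ n → fromℕ (suc n) ≡ 1ℚ + fromℕ n
fromℕ-suc = fromℕ-+ 1

fromℕ-* : ∀ m n → fromℕ (m ℕ.* n) ≡ fromℕ m * fromℕ n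
fromℕ-* zero    n = sym (*-zeroˡ (fromℕ n))
fromℕ-* (suc m) n = begin
  fromℕ (n ℕ.+ m ℕ.* n)        ≡⟨ fromℕ-+ n (m ℕ.* n) ⟩
  fromℕ n + fromℕ (m ℕ.* n)    ≡⟨ cong (λ x → fromℕ n + x) (fromℕ-* m n) ⟩
  fromℕ n + fromℕ m * fromℕ n  ≡⟨ distrib (fromℕ m) (fromℕ n) ⟩
  (1ℚ + fromℕ m) * fromℕ n     ≡⟨ cong (_* fromℕ n) (fromℕ-suc m) ⟨
  fromℕ (suc m) * fromℕ n      ∎
  where
  distrib : ∀ x y → y + x * y ≡ (1ℚ + x) * y
  distrib = solve-∀ ring

recip : ∀ p → 0ℚ < p → ℚ
recip p p>0 = 1/_ p {{>-nonZero p>0}}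

*-recip : ∀ p (p>0 : 0ℚ < p) → p * recip p p>0 ≡ 1ℚ
*-recip p p>0 = *-inverseʳ p {{>-nonZero p>0}}

*-cancelʳ-pos : ∀ {p x y} → 0ℚ < p → x * p ≡ y * p → x ≡ y
*-cancelʳ-pos {p} {x} {y} p>0 eq = begin
  x            ≡⟨ expand x ⟩
  x * p * p⁻¹  ≡⟨ cong (_* p⁻¹) eq ⟩
  y * p * p⁻¹  ≡⟨ expand y ⟨
  y            ∎
  where
  p⁻¹ = recip p p>0
  expand : ∀ z → z ≡ z * p * p⁻¹
  expand z = begin
    z              ≡⟨ *-identityʳ z ⟨
    z * 1ℚ         ≡⟨ cong (z *_) (*-recip p p>0) ⟨
    z * (p * p⁻¹)  ≡⟨ *-assoc z p p⁻¹ ⟨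
    z * p * p⁻¹    ∎

-- Serves to rewrite the reciprocals of several denominators as multiples of a single one, after
-- which only polynomial identities remain.
recip-unique : ∀ {p x} (p>0 : 0ℚ < p) → p * x ≡ 1ℚ → recip p p>0 ≡ x
recip-unique {p} {x} p>0 px≡1 = *-cancelʳ-pos p>0 (begin
  recip p p>0 * p  ≡⟨ *-comm _ p ⟩
  p * recip p p>0  ≡⟨ *-recip p p>0 ⟩
  1ℚ               ≡⟨ px≡1 ⟨
  p * x            ≡⟨ *-comm p x ⟩
  x * p            ∎)

^-pos : ∀ {p} → 0ℚ < p → ∀ n → 0ℚ < p ^ n
^-pos p>0 zero    = positive⁻¹ 1ℚ
^-pos p>0 (suc n) = *-pos p>0 (^-pos p>0 n)

-- Rising factorials as finite products, and the multiplication formula.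

rising-suc : ∀ a n → rising a (suc n) ≡ a * rising (1ℚ + a) n
rising-suc a zero    = base a
  where
  base : ∀ a → 1ℚ * (a + 0ℚ) ≡ a * 1ℚ
  base = solve-∀ ring
rising-suc a (suc n) = begin
  rising a (suc n) * (a + fromℕ (suc n))          ≡⟨ cong₂ (λ x y → x * (a + y)) (rising-suc a n) (fromℕ-suc n) ⟩
  a * rising (1ℚ + a) n * (a + (1ℚ + fromℕ n))    ≡⟨ regroup a (rising (1ℚ + a) n) (fromℕ n) ⟩
  a * (rising (1ℚ + a) n * (1ℚ + a + fromℕ n))    ∎
  where
  regroup : ∀ a x k → a * x * (a + (1ℚ + k)) ≡ a * (x * (1ℚ + a + k))
  regroup = solve-∀ ring

rising-+ : ∀ a m n → rising a (m ℕ.+ n) ≡ rising a m * rising (a + fromℕ m) n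
rising-+ a m zero    = trans (cong (rising a) (ℕ.+-identityʳ m)) (sym (*-identityʳ _))
rising-+ a m (suc n) = begin
  rising a (m ℕ.+ suc n)                                      ≡⟨ cong (rising a) (ℕ.+-suc m n) ⟩
  rising a (m ℕ.+ n) * (a + fromℕ (m ℕ.+ n))                  ≡⟨ cong₂ (λ x y → x * (a + y)) (rising-+ a m n) (fromℕ-+ m n) ⟩
  rising a m * rising (a + fromℕ m) n * (a + (fromℕ m + fromℕ n))
    ≡⟨ regroup (rising a m) (rising (a + fromℕ m) n) a (fromℕ m) (fromℕ n) ⟩
  rising a m * (rising (a + fromℕ m) n * (a + fromℕ m + fromℕ n)) ∎
  where
  regroup : ∀ x y a m n → x * y * (a + (m + n)) ≡ x * (y * (a + m + n))
  regroup = solve-∀ ring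

-- The factor of index `m` is `- m + m`; splitting the product just after it exposes this zero.
rising-vanishes : ∀ {m k} → m ℕ.< k → rising (- fromℕ m) k ≡ 0ℚ
rising-vanishes {m} m<k with ℕ.m≤n⇒∃[o]m+o≡n m<k
... | j , refl = begin
  rising (- x) (suc m ℕ.+ j)                    ≡⟨ rising-+ (- x) (suc m) j ⟩
  rising (- x) m * (- x + x) * rising (- x + fromℕ (suc m)) j
    ≡⟨ cancel (rising (- x) m) x _ ⟩
  0ℚ ∎
  where
  x = fromℕ m
  cancel : ∀ y x z → y * (- x + x) * z ≡ 0ℚ
  cancel = solve-∀ ring

-- Sums over `Fin` unfold at their first index, whereas the inductions on partial sums below append
-- a last term.
∑-init-last : ∀ (f : ℕ → ℚ) n → ∑[ k < suc n ] f (toℕ k) ≡ ∑[ k < n ] f (toℕ k) + f n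
∑-init-last f n = trans (sum-init-last {n} (f ∘ toℕ))
  (cong₂ _+_ (sum-cong-≗ {n} (cong f ∘ toℕ-inject₁)) (cong f (toℕ-fromℕ n)))

rising≡∏ : ∀ a n → rising a n ≡ ∏[ i < n ] (a + fromℕ (toℕ i))
rising≡∏ a zero    = refl
rising≡∏ a (suc n) = begin
  rising a n * (a + fromℕ n)                            ≡⟨ cong (_* (a + fromℕ n)) (rising≡∏ a n) ⟩
  product (t ∘ toℕ {n}) * t n                           ≡⟨ cong₂ _*_ (product-cong {n} (cong t ∘ toℕ-inject₁)) (cong t (toℕ-fromℕ n)) ⟨
  product (t ∘ toℕ ∘ Fin.inject₁ {n}) * t (toℕ (Fin.fromℕ n)) ≡⟨ product-init-last {n} (t ∘ toℕ) ⟨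
  product (t ∘ toℕ {suc n})                             ∎
  where
  t : ℕ → ℚ
  t i = a + fromℕ i

-- Gauss's multiplication formula, with r = 1/m.
rising-multiplication : ∀ m r q → fromℕ m * r ≡ 1ℚ → ∀ n →
  rising (fromℕ m * q) (m ℕ.* n) ≡
    (fromℕ m ^ m) ^ n * ∏[ i < m ] rising (q + r * fromℕ (toℕ i)) n
rising-multiplication m r q mr≡1 zero = begin
  rising (fromℕ m * q) (m ℕ.* 0)  ≡⟨ cong (rising _) (ℕ.*-zeroʳ m) ⟩
  1ℚ                              ≡⟨ ones m ⟨
  ∏[ i < m ] 1ℚ                   ≡⟨ *-identityˡ _ ⟨
  1ℚ * ∏[ i < m ] 1ℚ              ∎
  where
  ones : ∀ m → ∏[ i < m ] 1ℚ ≡ 1ℚ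
  ones zero    = refl
  ones (suc m) = trans (*-identityˡ _) (ones m)
rising-multiplication m r q mr≡1 (suc n) = begin
  rising x (m ℕ.* suc n)
    ≡⟨ cong (rising x) (trans (ℕ.*-suc m n) (ℕ.+-comm m (m ℕ.* n))) ⟩
  rising x (m ℕ.* n ℕ.+ m)
    ≡⟨ rising-+ x (m ℕ.* n) m ⟩
  -- The new block has `m` factors, and its `i`-th one is `m` times the next factor of the `i`-th
  -- rising factorial on the right.
  rising x (m ℕ.* n) * rising (x + fromℕ (m ℕ.* n)) m
    ≡⟨ cong₂ _*_ (rising-multiplication m r q mr≡1 n) block ⟩
  (M ^ m) ^ n * product P * (M ^ m * product L)
    ≡⟨ regroup ((M ^ m) ^ n) (product P) (M ^ m) (product L) ⟩
  M ^ m * (M ^ m) ^ n * (product P * product L)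
    ≡⟨ cong (M ^ m * (M ^ m) ^ n *_) (product-distrib-* {m} P L) ⟨
  (M ^ m) ^ suc n * ∏[ i < m ] (P i * L i) ∎
  where
  M = fromℕ m
  x = M * q
  P L : Fin.Fin m → ℚ
  P i = rising (q + r * fromℕ (toℕ i)) n
  L i = q + r * fromℕ (toℕ i) + fromℕ n
  regroup : ∀ u v w z → u * v * (w * z) ≡ w * u * (v * z)
  regroup = solve-∀ ring
  unscale : ∀ M q r n i → M * q + M * n + M * r * i ≡ M * (q + r * i + n)
  unscale = solve-∀ ring
  factor : ∀ i → x + fromℕ (m ℕ.* n) + fromℕ (toℕ i) ≡ M * L i
  factor i = begin
    x + fromℕ (m ℕ.* n) + k        ≡⟨ cong₂ (λ y z → x + y + z) (fromℕ-* m n) (sym (*-identityˡ k)) ⟩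
    -- Writing the offset `k` as `m r k` lets `m` be factored out of the whole sum.
    x + M * fromℕ n + 1ℚ * k       ≡⟨ cong (λ y → x + M * fromℕ n + y * k) mr≡1 ⟨
    x + M * fromℕ n + M * r * k    ≡⟨ unscale M q r (fromℕ n) k ⟩
    M * L i                        ∎
    where k = fromℕ (toℕ i)
  block : rising (x + fromℕ (m ℕ.* n)) m ≡ M ^ m * product L
  block = begin
    rising (x + fromℕ (m ℕ.* n)) m                      ≡⟨ rising≡∏ _ m ⟩
    ∏[ i < m ] (x + fromℕ (m ℕ.* n) + fromℕ (toℕ i))    ≡⟨ product-cong {m} factor ⟩
    ∏[ i < m ] (M * L i)                                ≡⟨ product-distrib-* {m} (λ _ → M) L ⟩
    product {m} (λ _ → M) * product L                   ≡⟨ cong (_* product L) (product-replicate m) ⟩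
    M ^ m * product L                                   ∎

-- The very-well-poised sum for general `a` and `d`, by creative telescoping.

module VeryWellPoised (a d : ℚ) (a>0 : 0ℚ < a) (d>0 : 0ℚ < d) where

  -- Well-poised pairing: `c` and `d` add up to `1 + a`, and so do `- N` and `top N`.
  c : ℚ
  c = 1ℚ + a - d

  top : ℕ → ℚ
  top N = fromℕ N + (1ℚ + a)

  top>0 : ∀ N → 0ℚ < top N
  top>0 N = fromℕ+-pos N (+-mono-< (positive⁻¹ 1ℚ) a>0)

  denominator : ℕ → ℕ → ℚ
  denominator N k = fromℕ (k !) * rising (top N) k * rising d k

  denominator>0 : ∀ N k → 0ℚ < denominator N k
  denominator>0 N k =
    *-pos (*-pos (factorial-pos k) (rising-pos (top>0 N) k)) (rising-pos d>0 k)

  -- The factor `a + 2k` equals `a (1 + a/2)_k / (a/2)_k`, so this is `a` times the usual term of a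
  -- very-well-poised 4F3 at -1; hence the factor `a` in the closed form.
  term : ℕ → ℕ → ℚ
  term N k = (- 1ℚ) ^ k * (a + fromℕ 2 * fromℕ k)
    * ((rising (- fromℕ N) k * rising c k * rising a k) * recip (denominator N k) (denominator>0 N k))

  partialSum : ℕ → ℕ → ℚ
  partialSum N K = ∑[ k < K ] term N (toℕ k)

  -- The k-th terms for N and for N + 1 are both polynomial multiples of its reciprocal V.
  commonDenominator : ℕ → ℕ → ℚ
  commonDenominator N k = fromℕ (k !) * rising (top N) (suc k) * rising d k

  commonDenominator>0 : ∀ N k → 0ℚ < commonDenominator N k
  commonDenominator>0 N k =
    *-pos (*-pos (factorial-pos k) (rising-pos (top>0 N) (suc k))) (rising-pos d>0 k)

  V : ℕ → ℕ → ℚ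
  V N k = recip (commonDenominator N k) (commonDenominator>0 N k)

  *-V : ∀ N k → commonDenominator N k * V N k ≡ 1ℚ
  *-V N k = *-recip _ (commonDenominator>0 N k)

  -- The common denominator exceeds this one by the last factor of `rising (top N) (suc k)`.
  recip-denominator : ∀ N k → recip (denominator N k) (denominator>0 N k) ≡ (top N + fromℕ k) * V N k
  recip-denominator N k = recip-unique (denominator>0 N k)
    (trans (regroup (fromℕ (k !)) (rising (top N) k) (rising d k) (top N + fromℕ k) (V N k)) (*-V N k))
    where
    regroup : ∀ f t e x v → f * t * e * (x * v) ≡ f * (t * x) * e * v
    regroup = solve-∀ ring

  top-suc : ∀ N → top (suc N) ≡ 1ℚ + top N
  top-suc N = trans (cong (_+ (1ℚ + a)) (fromℕ-suc N)) (+-assoc 1ℚ (fromℕ N) (1ℚ + a))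

  -- Passing to `N + 1` shifts the base by one, so here the common denominator has an extra first
  -- factor instead, which `rising-suc` peels off.
  recip-denominator-suc : ∀ N k → recip (denominator (suc N) k) (denominator>0 (suc N) k) ≡ top N * V N k
  recip-denominator-suc N k = recip-unique (denominator>0 (suc N) k) (begin
    fromℕ (k !) * rising (top (suc N)) k * rising d k * (top N * V N k)
      ≡⟨ cong (λ x → fromℕ (k !) * rising x k * rising d k * (top N * V N k)) (top-suc N) ⟩
    fromℕ (k !) * rising (1ℚ + top N) k * rising d k * (top N * V N k)
      ≡⟨ regroup (fromℕ (k !)) (rising (1ℚ + top N) k) (rising d k) (top N) (V N k) ⟩
    fromℕ (k !) * (top N * rising (1ℚ + top N) k) * rising d k * V N k
      ≡⟨ cong (λ x → fromℕ (k !) * x * rising d k * V N k) (rising-suc (top N) k) ⟨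
    commonDenominator N k * V N k
      ≡⟨ *-V N k ⟩
    1ℚ ∎)
    where
    regroup : ∀ f t e x v → f * t * e * (x * v) ≡ f * (x * t) * e * v
    regroup = solve-∀ ring

  V-step : ∀ N k → V N k ≡
    fromℕ (suc k) * (top N + fromℕ (suc k)) * (d + fromℕ k) * V N (suc k)
  V-step N k = recip-unique (commonDenominator>0 N k) (begin
    fromℕ (k !) * T * D * (x * y * z * v)   ≡⟨ regroup (fromℕ (k !)) T D x y z v ⟩
    x * fromℕ (k !) * (T * y) * (D * z) * v ≡⟨ cong (λ w → w * (T * y) * (D * z) * v) (fromℕ-* (suc k) (k !)) ⟨
    commonDenominator N (suc k) * v         ≡⟨ *-V N (suc k) ⟩
    1ℚ ∎)
    where
    T = rising (top N) (suc k)
    D = rising d k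
    x = fromℕ (suc k)
    y = top N + fromℕ (suc k)
    z = d + fromℕ k
    v = V N (suc k)
    regroup : ∀ f T D x y z v → f * T * D * (x * y * z * v) ≡ x * f * (T * y) * (D * z) * v
    regroup = solve-∀ ring

  -- Zeilberger's certificate for the recurrence in N, shifted by one in k.
  certificate : ℕ → ℕ → ℚ
  certificate N k =
    - (top N * (- 1ℚ) ^ k * rising (- fromℕ N) k * rising a (suc k) * rising c (suc k) * V N k)

  -- This lemma and the next three express all parts of the telescoping relation through
  -- `V N (suc k)` and rising factorials of length `k`, so that these can be treated as
  -- indeterminates.
  term-suc : ∀ N k → term N (suc k) ≡
    (- 1ℚ) * (- 1ℚ) ^ k * (a + fromℕ 2 * (1ℚ + fromℕ k))
      * (((rising (- fromℕ N) k * (- fromℕ N + fromℕ k)) * (rising c k * (c + fromℕ k)) * (rising a k * (a + fromℕ k)))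
         * ((top N + (1ℚ + fromℕ k)) * V N (suc k)))
  term-suc N k = cong₂ (λ x y → (- 1ℚ) ^ suc k * (a + fromℕ 2 * x)
      * ((rising (- fromℕ N) (suc k) * rising c (suc k) * rising a (suc k)) * y))
    (fromℕ-suc k)
    (trans (recip-denominator N (suc k)) (cong (λ x → (top N + x) * V N (suc k)) (fromℕ-suc k)))

  term-suc-suc : ∀ N k → term (suc N) (suc k) ≡
    (- 1ℚ) * (- 1ℚ) ^ k * (a + fromℕ 2 * (1ℚ + fromℕ k))
      * ((- (1ℚ + fromℕ N) * rising (- fromℕ N) k * (rising c k * (c + fromℕ k)) * (rising a k * (a + fromℕ k)))
         * (top N * V N (suc k)))
  term-suc-suc N k = trans
    (cong₂ (λ x y → (- 1ℚ) ^ suc k * (a + fromℕ 2 * x)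
        * ((rising (- fromℕ (suc N)) (suc k) * rising c (suc k) * rising a (suc k)) * y))
      (fromℕ-suc k) (recip-denominator-suc N (suc k)))
    (cong (λ x → (- 1ℚ) ^ suc k * (a + fromℕ 2 * (1ℚ + fromℕ k))
        * ((x * rising c (suc k) * rising a (suc k)) * (top N * V N (suc k))))
      shift)
    where
    negate : ∀ x → 1ℚ + - (1ℚ + x) ≡ - x
    negate = solve-∀ ring
    -- Peeling off the first factor turns the base `- (N + 1)` into `- N`, the base used in
    -- `term-suc`.
    shift : rising (- fromℕ (suc N)) (suc k) ≡ - (1ℚ + fromℕ N) * rising (- fromℕ N) k
    shift = begin
      rising (- fromℕ (suc N)) (suc k)                           ≡⟨ cong (λ x → rising (- x) (suc k)) (fromℕ-suc N) ⟩
      rising (- (1ℚ + fromℕ N)) (suc k)                          ≡⟨ rising-suc (- (1ℚ + fromℕ N)) k ⟩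
      - (1ℚ + fromℕ N) * rising (1ℚ + - (1ℚ + fromℕ N)) k        ≡⟨ cong (λ x → - (1ℚ + fromℕ N) * rising x k) (negate (fromℕ N)) ⟩
      - (1ℚ + fromℕ N) * rising (- fromℕ N) k                    ∎

  certificate-V : ∀ N k → certificate N k ≡
    - (top N * (- 1ℚ) ^ k * rising (- fromℕ N) k * rising a (suc k) * rising c (suc k)
       * ((1ℚ + fromℕ k) * (top N + (1ℚ + fromℕ k)) * (d + fromℕ k) * V N (suc k)))
  certificate-V N k = cong
    (λ x → - (top N * (- 1ℚ) ^ k * rising (- fromℕ N) k * rising a (suc k) * rising c (suc k) * x))
    (trans (V-step N k) (cong (λ x → x * (top N + x) * (d + fromℕ k) * V N (suc k)) (fromℕ-suc k)))

  certificate-suc : ∀ N k → certificate N (suc k) ≡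
    - (top N * ((- 1ℚ) * (- 1ℚ) ^ k) * (rising (- fromℕ N) k * (- fromℕ N + fromℕ k))
       * (rising a k * (a + fromℕ k) * (a + (1ℚ + fromℕ k)))
       * (rising c k * (c + fromℕ k) * (c + (1ℚ + fromℕ k))) * V N (suc k))
  certificate-suc N k = cong
    (λ x → - (top N * (- 1ℚ) ^ suc k * rising (- fromℕ N) (suc k)
              * (rising a (suc k) * (a + x)) * (rising c (suc k) * (c + x)) * V N (suc k)))
    (fromℕ-suc k)

  -- The telescoping relation, arranged without subtraction: once everything is over `V N (suc k)`
  -- it is a polynomial identity.
  certificate-step : ∀ N k →
    (d + fromℕ N) * term (suc N) (suc k) + certificate N k ≡
    top N * term N (suc k) + certificate N (suc k)
  certificate-step N k = begin
    (d + ν) * term (suc N) (suc k) + certificate N k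
      ≡⟨ cong₂ (λ x y → (d + ν) * x + y) (term-suc-suc N k) (certificate-V N k) ⟩
    (d + ν) * ((- 1ℚ) * s * (a + fromℕ 2 * (1ℚ + κ))
        * ((- (1ℚ + ν) * p * (q * (c + κ)) * (r * (a + κ))) * (top N * v)))
      + - (top N * s * p * (r * (a + κ)) * (q * (c + κ)) * ((1ℚ + κ) * (top N + (1ℚ + κ)) * (d + κ) * v))
      ≡⟨ identity s p r q v a d ν κ ⟩
    top N * ((- 1ℚ) * s * (a + fromℕ 2 * (1ℚ + κ))
        * (((p * (- ν + κ)) * (q * (c + κ)) * (r * (a + κ))) * ((top N + (1ℚ + κ)) * v)))
      + - (top N * ((- 1ℚ) * s) * (p * (- ν + κ)) * (r * (a + κ) * (a + (1ℚ + κ)))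
           * (q * (c + κ) * (c + (1ℚ + κ))) * v)
      ≡⟨ cong₂ (λ x y → top N * x + y) (term-suc N k) (certificate-suc N k) ⟨
    top N * term N (suc k) + certificate N (suc k) ∎
    where
    ν = fromℕ N
    κ = fromℕ k
    s = (- 1ℚ) ^ k
    p = rising (- ν) k
    q = rising c k
    r = rising a k
    v = V N (suc k)
    -- `c` and `top N` are spelled out so that the solver can use their relation to `a`, `d` and
    -- `N`.
    identity : ∀ s p r q v a d N k →
      (d + N) * ((- 1ℚ) * s * (a + fromℕ 2 * (1ℚ + k))
        * ((- (1ℚ + N) * p * (q * (1ℚ + a - d + k)) * (r * (a + k))) * ((N + (1ℚ + a)) * v)))
      + - ((N + (1ℚ + a)) * s * p * (r * (a + k)) * (q * (1ℚ + a - d + k))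
           * ((1ℚ + k) * (N + (1ℚ + a) + (1ℚ + k)) * (d + k) * v))
      ≡ (N + (1ℚ + a)) * ((- 1ℚ) * s * (a + fromℕ 2 * (1ℚ + k))
        * (((p * (- N + k)) * (q * (1ℚ + a - d + k)) * (r * (a + k))) * ((N + (1ℚ + a) + (1ℚ + k)) * v)))
      + - ((N + (1ℚ + a)) * ((- 1ℚ) * s) * (p * (- N + k)) * (r * (a + k) * (a + (1ℚ + k)))
           * (q * (1ℚ + a - d + k) * (1ℚ + a - d + (1ℚ + k))) * v)
    identity = solve-∀ ring

  partialSum-one : ∀ N → partialSum N 1 ≡ a * recip (denominator N 0) (denominator>0 N 0)
  partialSum-one N = simplify a (recip (denominator N 0) (denominator>0 N 0))
    where
    simplify : ∀ a x → 1ℚ * (a + fromℕ 2 * fromℕ 0) * (1ℚ * 1ℚ * 1ℚ * x) + 0ℚ ≡ a * x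
    simplify = solve-∀ ring

  certificate-zero : ∀ N → certificate N 0 ≡ - (top N * a * c * V N 0)
  certificate-zero N = simplify (top N) a c (V N 0)
    where
    simplify : ∀ t a c v →
      - (t * 1ℚ * 1ℚ * (1ℚ * (a + fromℕ 0)) * (1ℚ * (c + fromℕ 0)) * v) ≡ - (t * a * c * v)
    simplify = solve-∀ ring

  -- Summing `certificate-step` telescopes and leaves only the certificate at the upper end. The
  -- terms at `k = 0`, which that relation does not reach, form the base case.
  partialSum-recurrence : ∀ N K →
    (d + fromℕ N) * partialSum (suc N) (suc K) ≡ top N * partialSum N (suc K) + certificate N K
  partialSum-recurrence N zero = begin
    (d + ν) * partialSum (suc N) 1
      ≡⟨ cong ((d + ν) *_) (trans (partialSum-one (suc N)) (cong (a *_) (recip-denominator-suc N 0))) ⟩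
    (d + ν) * (a * (top N * v))
      -- Up to the common factor `a * top N * v` this says `d + N = top N - c`.
      ≡⟨ identity a d ν v ⟩
    top N * (a * ((top N + fromℕ 0) * v)) + - (top N * a * c * v)
      ≡⟨ cong₂ (λ x y → top N * x + y)
           (trans (partialSum-one N) (cong (a *_) (recip-denominator N 0)))
           (certificate-zero N) ⟨
    top N * partialSum N 1 + certificate N 0 ∎
    where
    ν = fromℕ N
    v = V N 0
    identity : ∀ a d ν v →
      (d + ν) * (a * ((ν + (1ℚ + a)) * v))
      ≡ (ν + (1ℚ + a)) * (a * ((ν + (1ℚ + a) + fromℕ 0) * v))
        + - ((ν + (1ℚ + a)) * a * (1ℚ + a - d) * v)
    identity = solve-∀ ring
  partialSum-recurrence N (suc K) = begin
    e * partialSum (suc N) (suc (suc K))                 ≡⟨ cong (e *_) (∑-init-last (term (suc N)) (suc K)) ⟩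
    e * (partialSum (suc N) (suc K) + term (suc N) (suc K)) ≡⟨ *-distribˡ-+ e _ _ ⟩
    e * partialSum (suc N) (suc K) + e * term (suc N) (suc K) ≡⟨ cong (_+ e * term (suc N) (suc K)) (partialSum-recurrence N K) ⟩
    t * partialSum N (suc K) + certificate N K + e * term (suc N) (suc K)
      ≡⟨ swap (t * partialSum N (suc K)) (certificate N K) (e * term (suc N) (suc K)) ⟩
    t * partialSum N (suc K) + (e * term (suc N) (suc K) + certificate N K)
      ≡⟨ cong (λ x → t * partialSum N (suc K) + x) (certificate-step N K) ⟩
    t * partialSum N (suc K) + (t * term N (suc K) + certificate N (suc K))
      ≡⟨ collect t (partialSum N (suc K)) (term N (suc K)) (certificate N (suc K)) ⟩
    t * (partialSum N (suc K) + term N (suc K)) + certificate N (suc K)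
      ≡⟨ cong (λ s → t * s + certificate N (suc K)) (∑-init-last (term N) (suc K)) ⟨
    t * partialSum N (suc (suc K)) + certificate N (suc K) ∎
    where
    e = d + fromℕ N
    t = top N
    swap : ∀ x y z → x + y + z ≡ x + (z + y)
    swap = solve-∀ ring
    collect : ∀ t x y z → t * x + (t * y + z) ≡ t * (x + y) + z
    collect = solve-∀ ring

  term-vanishes : ∀ {N k} → N ℕ.< k → term N k ≡ 0ℚ
  term-vanishes {N} {k} N<k = trans
    (cong (λ z → (- 1ℚ) ^ k * (a + fromℕ 2 * fromℕ k) * (z * rising c k * rising a k * I)) (rising-vanishes N<k))
    (zero-factor ((- 1ℚ) ^ k * (a + fromℕ 2 * fromℕ k)) (rising c k) (rising a k) I)
    where
    I = recip (denominator N k) (denominator>0 N k)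
    zero-factor : ∀ w x y z → w * (0ℚ * x * y * z) ≡ 0ℚ
    zero-factor = solve-∀ ring

  certificate-vanishes : ∀ {N k} → N ℕ.< k → certificate N k ≡ 0ℚ
  certificate-vanishes {N} {k} N<k = trans
    (cong (λ z → - (top N * (- 1ℚ) ^ k * z * rising a (suc k) * rising c (suc k) * V N k)) (rising-vanishes N<k))
    (zero-factor (top N * (- 1ℚ) ^ k) (rising a (suc k)) (rising c (suc k)) (V N k))
    where
    zero-factor : ∀ w x y z → - (w * 0ℚ * x * y * z) ≡ 0ℚ
    zero-factor = solve-∀ ring

  -- At `K = N + 1` both the boundary certificate and the surplus term of the sum for `N` contain
  -- the zero of `(-N)_(N+1)`.
  sum-recurrence : ∀ N →
    (d + fromℕ N) * partialSum (suc N) (suc (suc N)) ≡ top N * partialSum N (suc N)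
  sum-recurrence N = begin
    (d + fromℕ N) * partialSum (suc N) (suc (suc N))     ≡⟨ partialSum-recurrence N (suc N) ⟩
    top N * partialSum N (suc (suc N)) + certificate N (suc N)
      ≡⟨ cong₂ (λ x y → top N * x + y) (∑-init-last (term N) (suc N)) (certificate-vanishes (ℕ.n<1+n N)) ⟩
    top N * (partialSum N (suc N) + term N (suc N)) + 0ℚ
      ≡⟨ cong (λ x → top N * (partialSum N (suc N) + x) + 0ℚ) (term-vanishes (ℕ.n<1+n N)) ⟩
    top N * (partialSum N (suc N) + 0ℚ) + 0ℚ
      ≡⟨ drop (top N) (partialSum N (suc N)) ⟩
    top N * partialSum N (suc N) ∎
    where
    drop : ∀ x y → x * (y + 0ℚ) + 0ℚ ≡ x * y
    drop = solve-∀ ring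

  -- Induction with the recurrence: the new factor `d + N` of `(d)_(N+1)` is its left coefficient,
  -- and `top N` is the new factor of `(1+a)_(N+1)`. The multiplied form avoids division.
  sum-closed-form : ∀ N → partialSum N (suc N) * rising d N ≡ a * rising (1ℚ + a) N
  sum-closed-form zero = cong (_* 1ℚ) (begin
    partialSum 0 1                                 ≡⟨ partialSum-one 0 ⟩
    a * recip (denominator 0 0) (denominator>0 0 0) ≡⟨ cong (a *_) (recip-unique (denominator>0 0 0) refl) ⟩
    a * 1ℚ                                         ≡⟨ *-identityʳ a ⟩
    a                                              ∎)
  sum-closed-form (suc N) = begin
    S′ * (rising d N * (d + fromℕ N))         ≡⟨ swap S′ (rising d N) (d + fromℕ N) ⟩
    (d + fromℕ N) * S′ * rising d N           ≡⟨ cong (_* rising d N) (sum-recurrence N) ⟩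
    top N * S * rising d N                    ≡⟨ *-assoc (top N) S (rising d N) ⟩
    top N * (S * rising d N)                  ≡⟨ cong (top N *_) (sum-closed-form N) ⟩
    top N * (a * rising (1ℚ + a) N)           ≡⟨ regroup (fromℕ N) a (rising (1ℚ + a) N) ⟩
    a * (rising (1ℚ + a) N * (1ℚ + a + fromℕ N)) ∎
    where
    S  = partialSum N (suc N)
    S′ = partialSum (suc N) (suc (suc N))
    swap : ∀ x y z → x * (y * z) ≡ z * x * y
    swap = solve-∀ ring
    regroup : ∀ N a r → (N + (1ℚ + a)) * (a * r) ≡ a * (r * (1ℚ + a + N))
    regroup = solve-∀ ring

-- Limits of terminating series.

finite⇒HasSum : ∀ {f s} m → (∀ {k} → m ℕ.≤ k → f k ≡ 0ℚ) →
  ∑[ k < m ] f (toℕ k) ≡ s → f HasSum s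
-- The distance to `s` is exactly 0 from `m` onwards, so `m` serves for every `ε`.
finite⇒HasSum {f} {s} m vanishes total ε ε>0 = m , λ N m≤N → subst (_< ε) (sym (dist N m≤N)) ε>0
  where
  stable : ∀ j → ∑[ k < j ℕ.+ m ] f (toℕ k) ≡ s
  stable zero    = total
  stable (suc j) = begin
    ∑[ k < suc (j ℕ.+ m) ] f (toℕ k)              ≡⟨ ∑-init-last f (j ℕ.+ m) ⟩
    ∑[ k < j ℕ.+ m ] f (toℕ k) + f (j ℕ.+ m)      ≡⟨ cong₂ _+_ (stable j) (vanishes (ℕ.m≤n+m m j)) ⟩
    s + 0ℚ                                        ≡⟨ +-identityʳ s ⟩
    s                                             ∎
  dist : ∀ N → m ℕ.≤ N → ∣ (∑[ k < N ] f (toℕ k)) - s ∣ ≡ 0ℚ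
  dist N m≤N with ℕ.m≤n⇒∃[o]m+o≡n m≤N
  ... | j , refl = cong ∣_∣ (begin
    (∑[ k < m ℕ.+ j ] f (toℕ k)) - s  ≡⟨ cong (λ i → (∑[ k < i ] f (toℕ k)) - s) (ℕ.+-comm m j) ⟩
    (∑[ k < j ℕ.+ m ] f (toℕ k)) - s  ≡⟨ cong (_- s) (stable j) ⟩
    s - s                             ≡⟨ +-inverseʳ s ⟩
    0ℚ                                ∎)

-- Specialisation to `a = 1/2`, `d = 3n + 7/4`, `N = 2n`, and the product side.

module _ (n : ℕ) where

  private
    d : ℚ
    d = fromℕ (3 ℕ.* n) + + 7 / 4

    d>0 : 0ℚ < d
    d>0 = fromℕ+-pos (3 ℕ.* n) (positive⁻¹ (+ 7 / 4))

  open VeryWellPoised ½ d (positive⁻¹ ½) d>0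

  summand≡2*term : ∀ k → summand n k ≡ fromℕ 2 * term (2 ℕ.* n) k
  summand≡2*term k = begin
    -- This is `summand n k` by computation: `1ℚ + ½` reduces to 3/2, and `1/_` does not depend on
    -- which proof of nonzeroness it receives.
    s * fromℕ (4 ℕ.* k ℕ.+ 1) * (A * rising (- fromℕ (3 ℕ.* n) - + 1 / 4) k * R * I)
      ≡⟨ cong₂ (λ x y → s * x * (A * rising y k * R * I)) linear (parameter (fromℕ (3 ℕ.* n))) ⟩
    s * (fromℕ 2 * (½ + fromℕ 2 * fromℕ k)) * (A * rising c k * R * I)
      ≡⟨ regroup s (fromℕ k) (A * rising c k * R * I) ⟩
    fromℕ 2 * (s * (½ + fromℕ 2 * fromℕ k) * (A * rising c k * R * I)) ∎
    where
    s = (- 1ℚ) ^ k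
    A = rising (- fromℕ (2 ℕ.* n)) k
    R = rising ½ k
    I = recip (denominator (2 ℕ.* n) k) (denominator>0 (2 ℕ.* n) k)
    parameter : ∀ x → - x - + 1 / 4 ≡ 1ℚ + ½ - (x + + 7 / 4)
    parameter = solve-∀ ring
    scale : ∀ x → fromℕ 4 * x + fromℕ 1 ≡ fromℕ 2 * (½ + fromℕ 2 * x)
    scale = solve-∀ ring
    linear : fromℕ (4 ℕ.* k ℕ.+ 1) ≡ fromℕ 2 * (½ + fromℕ 2 * fromℕ k)
    linear = trans (fromℕ-+ (4 ℕ.* k) 1)
      (trans (cong (_+ fromℕ 1) (fromℕ-* 4 k)) (scale (fromℕ k)))
    regroup : ∀ s k x → s * (fromℕ 2 * (½ + fromℕ 2 * k)) * x ≡ fromℕ 2 * (s * (½ + fromℕ 2 * k) * x)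
    regroup = solve-∀ ring

  -- The bound `suc (2n)` includes `k = 2n`, the last index before `(-2n)_k` vanishes.
  total : ℚ
  total = ∑[ k < suc (2 ℕ.* n) ] summand n (toℕ k)

  total*rising : total * rising d (2 ℕ.* n) ≡ rising (+ 3 / 2) (2 ℕ.* n)
  total*rising = begin
    total * D
      ≡⟨ cong (_* D) (sum-cong-≗ {suc N} (summand≡2*term ∘ toℕ)) ⟩
    (∑[ k < suc N ] (fromℕ 2 * term N (toℕ k))) * D
      ≡⟨ cong (_* D) (*-distribˡ-sum {suc N} (fromℕ 2) (term N ∘ toℕ)) ⟨
    fromℕ 2 * partialSum N (suc N) * D
      ≡⟨ *-assoc (fromℕ 2) (partialSum N (suc N)) D ⟩
    fromℕ 2 * (partialSum N (suc N) * D)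
      ≡⟨ cong (fromℕ 2 *_) (sum-closed-form N) ⟩
    fromℕ 2 * (½ * rising (1ℚ + ½) N)
      ≡⟨ double (rising (+ 3 / 2) N) ⟩
    rising (+ 3 / 2) N ∎
    where
    N = 2 ℕ.* n
    D = rising d N
    double : ∀ x → fromℕ 2 * (½ * x) ≡ x
    double = solve-∀ ring

  summand-vanishes : ∀ {k} → 2 ℕ.* n ℕ.< k → summand n k ≡ 0ℚ
  summand-vanishes {k} 2n<k =
    trans (summand≡2*term k) (cong (fromℕ 2 *_) (term-vanishes 2n<k))

  -- The numbers `7/20 + i/5` are the four parameters of the denominator together with 3/4.
  -- Multiplying by `5^(5n) (3/4)_n` therefore completes it to `(7/4)_(5n)`; the auxiliary factors
  -- cancel at the end.
  total*denominator : total * productDenominator n ≡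
    (+ (2 ℕ.^ 2 ℕ.* 3 ℕ.^ 3) / (5 ℕ.^ 5)) ^ n
      * (rising (+ 11 / 12) n * rising (+ 7 / 12) n * rising (+ 5 / 4) n ^ 2)
  total*denominator = *-cancelʳ-pos (*-pos 5ⁿ>0 r₃>0) (begin
    total * productDenominator n * (5ⁿ * r₃)
      ≡⟨ expand₅ total 5ⁿ (rising (+ 7 / 20) n) (rising (+ 11 / 20) n) r₃ (rising (+ 19 / 20) n) (rising (+ 23 / 20) n) ⟩
    total * (5ⁿ * ∏[ i < 5 ] rising (+ 7 / 20 + + 1 / 5 * fromℕ (toℕ i)) n)
      ≡⟨ cong (total *_) (rising-multiplication 5 (+ 1 / 5) (+ 7 / 20) refl n) ⟨
    total * rising (+ 7 / 4) (5 ℕ.* n)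
      -- Splitting `5n` as `3n + 2n` makes the second part `(d)_(2n)`, which `total*rising` absorbs.
      ≡⟨ cong (λ m → total * rising (+ 7 / 4) m) (ℕ.*-distribʳ-+ n 3 2) ⟩
    total * rising (+ 7 / 4) (3 ℕ.* n ℕ.+ 2 ℕ.* n)
      ≡⟨ cong (total *_) (rising-+ (+ 7 / 4) (3 ℕ.* n) (2 ℕ.* n)) ⟩
    total * (rising (+ 7 / 4) (3 ℕ.* n) * rising (+ 7 / 4 + fromℕ (3 ℕ.* n)) (2 ℕ.* n))
      ≡⟨ cong (λ x → total * (rising (+ 7 / 4) (3 ℕ.* n) * rising x (2 ℕ.* n))) (+-comm (+ 7 / 4) (fromℕ (3 ℕ.* n))) ⟩
    total * (rising (+ 7 / 4) (3 ℕ.* n) * rising d (2 ℕ.* n))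
      ≡⟨ swap total (rising (+ 7 / 4) (3 ℕ.* n)) (rising d (2 ℕ.* n)) ⟩
    rising (+ 7 / 4) (3 ℕ.* n) * (total * rising d (2 ℕ.* n))
      ≡⟨ cong (rising (+ 7 / 4) (3 ℕ.* n) *_) total*rising ⟩
    rising (+ 7 / 4) (3 ℕ.* n) * rising (+ 3 / 2) (2 ℕ.* n)
      ≡⟨ cong₂ _*_ (rising-multiplication 3 (+ 1 / 3) (+ 7 / 12) refl n)
                   (rising-multiplication 2 (+ 1 / 2) (+ 3 / 4) refl n) ⟩
    3ⁿ * ∏[ i < 3 ] rising (+ 7 / 12 + + 1 / 3 * fromℕ (toℕ i)) n
      * (2ⁿ * ∏[ i < 2 ] rising (+ 3 / 4 + + 1 / 2 * fromℕ (toℕ i)) n)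
      -- The parameters are 7/12, 11/12, 5/4 and 3/4, 5/4: `(5/4)_n` occurs twice, and `(3/4)_n`
      -- matches the auxiliary factor.
      ≡⟨ expand₃₂ 3ⁿ 2ⁿ (rising (+ 7 / 12) n) (rising (+ 11 / 12) n) (rising (+ 5 / 4) n) r₃ ⟩
    3ⁿ * 2ⁿ * Num * r₃
      ≡⟨ cong (λ x → x * Num * r₃) powers ⟩
    pⁿ * 5ⁿ * Num * r₃
      ≡⟨ regroup pⁿ 5ⁿ Num r₃ ⟩
    pⁿ * Num * (5ⁿ * r₃) ∎)
    where
    p = + (2 ℕ.^ 2 ℕ.* 3 ℕ.^ 3) / (5 ℕ.^ 5)
    pⁿ = p ^ n
    2ⁿ = (fromℕ 2 ^ 2) ^ n
    3ⁿ = (fromℕ 3 ^ 3) ^ n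
    5ⁿ = (fromℕ 5 ^ 5) ^ n
    r₃ = rising (+ 3 / 4) n
    Num = rising (+ 11 / 12) n * rising (+ 7 / 12) n * rising (+ 5 / 4) n ^ 2
    5ⁿ>0 : 0ℚ < 5ⁿ
    5ⁿ>0 = ^-pos (positive⁻¹ (fromℕ 5 ^ 5)) n
    r₃>0 : 0ℚ < r₃
    r₃>0 = rising-pos (positive⁻¹ (+ 3 / 4)) n
    powers : 3ⁿ * 2ⁿ ≡ pⁿ * 5ⁿ
    -- The two halves meet because `3^3 * 2^2` and `p * 5^5` both compute to 108.
    powers = trans (sym (^-distrib-* (fromℕ 3 ^ 3) (fromℕ 2 ^ 2) n)) (^-distrib-* p (fromℕ 5 ^ 5) n)
    expand₅ : ∀ t f x₀ x₁ x₂ x₃ x₄ →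
      t * (x₁ * x₃ * x₄ * x₀) * (f * x₂) ≡ t * (f * (x₀ * (x₁ * (x₂ * (x₃ * (x₄ * 1ℚ))))))
    expand₅ = solve-∀ ring
    expand₃₂ : ∀ t₃ t₂ x₀ x₁ x₂ y₀ →
      t₃ * (x₀ * (x₁ * (x₂ * 1ℚ))) * (t₂ * (y₀ * (x₂ * 1ℚ))) ≡
      t₃ * t₂ * (x₁ * x₀ * (x₂ * (x₂ * 1ℚ))) * y₀
    expand₃₂ = solve-∀ ring
    swap : ∀ x y z → x * (y * z) ≡ y * (x * z)
    swap = solve-∀ ring
    regroup : ∀ x y z w → x * y * z * w ≡ x * z * (y * w)
    regroup = solve-∀ ring

  total≡productSide : total ≡ productSide n
  total≡productSide = *-cancelʳ-pos D>0 (begin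
    total * D                ≡⟨ total*denominator ⟩
    x * Num                  ≡⟨ *-identityʳ (x * Num) ⟨
    x * Num * 1ℚ             ≡⟨ cong (x * Num *_) (*-recip D D>0) ⟨
    x * Num * (D * D⁻¹)      ≡⟨ regroup x Num D D⁻¹ ⟩
    x * (Num * D⁻¹) * D      ∎)
    where
    D = productDenominator n
    D>0 : 0ℚ < D
    D>0 = *-pos (*-pos (*-pos (rising-pos (positive⁻¹ (+ 11 / 20)) n)
                              (rising-pos (positive⁻¹ (+ 19 / 20)) n))
                       (rising-pos (positive⁻¹ (+ 23 / 20)) n))
                (rising-pos (positive⁻¹ (+ 7 / 20)) n)
    D⁻¹ = recip D D>0
    x = (+ (2 ℕ.^ 2 ℕ.* 3 ℕ.^ 3) / (5 ℕ.^ 5)) ^ n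
    Num = rising (+ 11 / 12) n * rising (+ 7 / 12) n * rising (+ 5 / 4) n ^ 2
    regroup : ∀ x y z w → x * y * (z * w) ≡ x * (y * w) * z
    regroup = solve-∀ ring

theorem9 : ∀ (n : ℕ) → summand n HasSum productSide n
theorem9 n = finite⇒HasSum (suc (2 ℕ.* n)) (summand-vanishes n) (total≡productSide n)
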